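{- Let $d\ge1$, $P\subseteq\mathbb R\times[d]$, $\alpha\in(0,1]$ and $\beta=1-(1-\alpha)^{1/(2d)}$. Let $\mathcal C_1,\dots,\mathcal C_{2d}$ be finite subfamilies of $\mathcal C_{\equiv}(P)$. If at least $\alpha|\mathcal C_1|\cdots|\mathcal C_{2d}|$ of the colorful $2d$-tuples $(C_1,\dots,C_{2d})\in\mathcal C_1\times\cdots\times\mathcal C_{2d}$ satisfy $C_1\cap\dots\cap C_{2d}\ne\emptyset$, then some $\mathcal C_i$ contains a subfamily of size $\beta|\mathcal C_i|$ whose members have a common point.
   Context: $[d]=\{1,\dots,d\}$. A (separated) $d$-interval is a set $I=\bigcup_{i\in[d]}\{(x,i): x\in I^{(i)}\}\subseteq\mathbb R\times[d]$ with each $I^{(i)}\subseteq\mathbb R$ convex (possibly empty). For $P\subseteq\mathbb R\times[d]$, $\mathcal C_{\equiv}(P)=\{I\cap P: I \text{ a } d\text{ -interval}\}$. -}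

module Defs where

open import Algebra.Bundles using (CommutativeRing)
import Algebra.Properties.Semiring.Exp as Exp
import Algebra.Properties.Semiring.Mult as Mult
open import Data.Fin using (Fin)
open import Data.List using (List; product; tabulate)
open import Data.List.Relation.Unary.AllPairs using (AllPairs)
open import Data.Nat using (ℕ)
open import Data.Product using (∃; _×_; _,_)
open import Data.Product.Relation.Binary.Pointwise.NonDependent using (Pointwise)
open import Function.Definitions using (Injective)
open import Level using (Level; suc)
open import Relation.Binary using (Rel; IsDecTotalOrder; _Respects_)
import Relation.Binary.Construct.NonStrictToStrict as NonStrictToStrict
open import Relation.Binary.PropositionalEquality using (_≡_)
open import Relation.Nullary using (¬_)
open import Relation.Unary using (Pred; _≐_; _∩_)

private
  variable
    ℓ : Level

-- The real numbers, axiomatised as a Dedekind-complete ordered field.  The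
-- order is decidable, as it is classically; excluded middle is not assumed
-- anywhere else.

record CompleteOrderedField (ℓ : Level) : Set (suc ℓ) where
  infix 4 _≤_
  field
    commutativeRing : CommutativeRing ℓ ℓ

  open CommutativeRing commutativeRing public

  field
    _≤_             : Rel Carrier ℓ
    isDecTotalOrder : IsDecTotalOrder _≈_ _≤_
    +-monoʳ-≤       : ∀ x {y z} → y ≤ z → x + y ≤ x + z
    *-nonNeg        : ∀ {x y} → 0# ≤ x → 0# ≤ y → 0# ≤ x * y
    0≉1             : ¬ 0# ≈ 1#
    *-inverse       : ∀ {x} → ¬ x ≈ 0# → ∃ λ y → x * y ≈ 1#

  UpperBound : Pred Carrier ℓ → Pred Carrier ℓ
  UpperBound S b = ∀ {x} → S x → x ≤ b

  field
    supremum : (S : Pred Carrier ℓ) → ∃ S → ∃ (UpperBound S) →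
               ∃ λ s → UpperBound S s × (∀ {b} → UpperBound S b → s ≤ b)

  open NonStrictToStrict _≈_ _≤_ public using (_<_)
  open Exp semiring public using (_^_)

  fromℕ : ℕ → Carrier
  fromℕ n = n ×′ 1#
    where open Mult semiring using () renaming (_×_ to _×′_)

  -- y = x^(1/n).  For 0 ≤ x and n ≥ 1 completeness gives existence, and the
  -- root is unique up to _≈_.
  record IsRoot (n : ℕ) (x y : Carrier) : Set ℓ where
    field
      nonNeg : 0# ≤ y
      power  : y ^ n ≈ x

module DIntervals (ℝ : CompleteOrderedField ℓ) (d : ℕ) where

  open CompleteOrderedField ℝ

  Convex : Pred Carrier ℓ → Set ℓ
  Convex S = ∀ {x y t} → S x → S y → 0# ≤ t → t ≤ 1# →
             S ((1# - t) * x + t * y)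

  -- ℝ × [d], with [d] indexed from zero
  Point : Set ℓ
  Point = Carrier × Fin d

  _≈ₚ_ : Rel Point ℓ
  _≈ₚ_ = Pointwise _≈_ _≡_

  -- The Respects fields here and in the theorem only say that a predicate is
  -- a subset of the setoid of reals.
  record DInterval : Set (suc ℓ) where
    field
      part     : Fin d → Pred Carrier ℓ
      respects : ∀ i → part i Respects _≈_
      convex   : ∀ i → Convex (part i)

  ⟦_⟧ : DInterval → Pred Point ℓ
  ⟦ I ⟧ (x , i) = DInterval.part I i x

  𝒞≡ : Pred Point ℓ → Pred (Pred Point ℓ) (suc ℓ)
  𝒞≡ P C = ∃ λ I → C ≐ (⟦ I ⟧ ∩ P)

  -- A finite set of elements of 𝒞≡ P, enumerated without repetition up to
  -- extensional equality of sets.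
  record FiniteSubfamily (P : Pred Point ℓ) : Set (suc ℓ) where
    field
      size     : ℕ
      member   : Fin size → Pred Point ℓ
      member∈  : ∀ a → 𝒞≡ P (member a)
      distinct : Injective _≡_ _≐_ member

  module _ {P : Pred Point ℓ} where

    open FiniteSubfamily

    ∏sizes : ∀ {m} → (Fin m → FiniteSubfamily P) → ℕ
    ∏sizes C = product (tabulate λ i → size (C i))

    ColorfulTuple : ∀ {m} → (Fin m → FiniteSubfamily P) → Set
    ColorfulTuple C = ∀ i → Fin (size (C i))

    -- Tuples are functions, so they are compared pointwise.
    AllDistinct : ∀ {m} (C : Fin m → FiniteSubfamily P) →
                  Pred (List (ColorfulTuple C)) _
    AllDistinct C = AllPairs λ s t → ¬ (∀ i → s i ≡ t i)

    Intersecting : ∀ {m} (C : Fin m → FiniteSubfamily P) →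
                   Pred (ColorfulTuple C) ℓ
    Intersecting C t = ∃ λ p → ∀ i → member (C i) (t i) p

module Submission where

open import Defs
import Algebra.Properties.CommutativeSemigroup as CommutativeSemigroup
import Algebra.Properties.Monoid.Mult as MonoidMult
import Algebra.Properties.Ring as RingProperties
import Algebra.Properties.Semiring.Mult as SemiringMult
open import Data.Bool using (true; false)
open import Data.Fin using (Fin; zero; suc; combine; fromℕ<; _↑ˡ_; _↑ʳ_)
import Data.Fin.Properties as Fin
open import Data.Fin.Subset using (Subset; ∣_∣; _∈_; ⊥)
open import Data.Fin.Subset.Properties using (∣⊥∣≡0; ∉⊥)
open import Data.List as List using (List; []; _∷_; length; allFin)
import Data.List.Extrema as Extrema
import Data.List.Extrema.Nat as ℕExtrema
open import Data.List.Membership.Propositional using () renaming (_∈_ to _∈ˡ_)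
open import Data.List.Membership.Propositional.Properties
open import Data.List.Properties using (length-map; length-++; length-tabulate; filter-++; filter-none)
open import Data.List.Relation.Binary.Permutation.Propositional.Properties using (↭-length; filter-↭; All-resp-↭)
open import Data.List.Relation.Unary.All as All using (All; []; _∷_)
import Data.List.Relation.Unary.All.Properties as All
open import Data.List.Relation.Unary.AllPairs as AllPairs using (AllPairs; []; _∷_)
import Data.List.Relation.Unary.AllPairs.Properties as AllPairs
open import Data.List.Relation.Unary.Any using (here; there)
import Data.List.Relation.Unary.Linked.Properties as Linked
open import Data.List.Relation.Unary.Unique.Propositional using (Unique)
import Data.List.Relation.Unary.Unique.Propositional.Properties as Unique
import Data.List.Sort as Sort
open import Data.Nat as ℕ using (ℕ; zero; suc; z≤n; s≤s)
open import Data.Nat.ListAction using (product)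
import Data.Nat.Properties as ℕ
open import Data.Product using (∃; _×_; _,_; proj₁; proj₂; uncurry)
open import Data.Sum using ([_,_]′; inj₁; inj₂)
import Data.Vec as Vec
import Data.Vec.Properties as Vec
open import Function using (_∘_; flip)
open import Level using (Level)
open import Relation.Binary as Binary using (REL; DecTotalOrder; _Respects_)
import Relation.Binary.Construct.On as On
open import Relation.Binary.PropositionalEquality as ≡ using (_≡_; refl; module ≡-Reasoning)
import Relation.Binary.Reasoning.Preorder as PreorderReasoning
import Relation.Binary.Reasoning.Setoid as SetoidReasoning
open import Relation.Nullary using (¬_; Dec; yes; no; does; contradiction)
open import Relation.Nullary.Decidable using (¬?; _×-dec_; decidable-stable)
open import Relation.Unary using (Pred; Decidable)

-- On each line l, pair up the families l and l + d.  Among intervals on a line,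
-- the one with the leftmost right end is met only by intervals through that end;
-- sweeping in this order shows that if no point lies in more than r of m
-- intervals of one family or s of n of the other, then at least (m - r)(n - s)
-- pairs are disjoint.  A tuple whose pairs are disjoint on their respective
-- lines has empty intersection, so at least ∏ (nᵢ - rᵢ) colorful tuples do not
-- intersect.  If rᵢ < β nᵢ for all i, then nᵢ - rᵢ > (1 - α)^(1/2d) nᵢ, and more
-- than (1 - α) ∏ nᵢ tuples do not intersect, a contradiction.

private variable
  a b p q : Level
  A : Set a
  B : Set b

module Combinatorics where

  open import Data.List hiding (product)
  open import Data.List.Relation.Binary.Permutation.Propositional using (_↭_; refl; prep; swap; trans; ↭-sym)
  open import Data.Nat hiding (zero; suc)
  open import Data.Nat.Properties
  open ≡ using (sym; cong; cong₂)
  open CommutativeSemigroup +-commutativeSemigroup using () renaming (x∙yz≈y∙xz to +-exchange)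
  open CommutativeSemigroup *-commutativeSemigroup using () renaming (interchange to *-interchange)

  -- Counting list elements and related pairs.

  1+m∸n≤1+[m∸n] : ∀ m n → suc m ∸ n ≤ suc (m ∸ n)
  1+m∸n≤1+[m∸n] m       zero    = ≤-refl
  1+m∸n≤1+[m∸n] zero    (suc n) = ≤-trans (≤-reflexive (0∸n≡0 n)) z≤n
  1+m∸n≤1+[m∸n] (suc m) (suc n) = 1+m∸n≤1+[m∸n] m n

  count : {P : Pred A p} → Decidable P → List A → ℕ
  count P? xs = length (filter P? xs)

  module _ {P : Pred A p} (P? : Decidable P) where

    count-∁ : ∀ xs → count P? xs + count (λ x → ¬? (P? x)) xs ≡ length xs
    count-∁ []       = refl
    count-∁ (x ∷ xs) with P? x
    ... | yes _ = cong suc (count-∁ xs)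
    ... | no  _ = ≡.trans (+-suc _ _) (cong suc (count-∁ xs))

    count-∷ : ∀ x xs → count P? xs ≤ count P? (x ∷ xs)
    count-∷ x xs with P? x
    ... | yes _ = n≤1+n _
    ... | no  _ = ≤-refl

    module _ {Q : Pred A q} (Q? : Decidable Q) where

      count-mono : ∀ {xs} → All (λ x → P x → Q x) xs → count P? xs ≤ count Q? xs
      count-mono []                  = z≤n
      count-mono {x ∷ xs} (P⇒Q ∷ ps) with P? x | Q? x
      ... | yes _  | yes _  = s≤s (count-mono ps)
      ... | yes px | no ¬qx = contradiction (P⇒Q px) ¬qx
      ... | no  _  | yes _  = m≤n⇒m≤1+n (count-mono ps)
      ... | no  _  | no  _  = count-mono ps

    count-↭ : ∀ {xs ys} → xs ↭ ys → count P? xs ≡ count P? ys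
    count-↭ = ↭-length ∘ filter-↭ P?

  module _ {R : REL A B p} (R? : Binary.Decidable R) where

    pairs : List A → List B → List (A × B)
    pairs xs ys = filter (uncurry R?) (cartesianProduct xs ys)

    length-pairs-∷ : ∀ x xs ys →
      length (pairs (x ∷ xs) ys) ≡ count (R? x) ys + length (pairs xs ys)
    length-pairs-∷ x xs ys = begin
      length (filter (uncurry R?) (map (x ,_) ys ++ cartesianProduct xs ys))
        ≡⟨ cong length (filter-++ (uncurry R?) (map (x ,_) ys) _) ⟩
      length (filter (uncurry R?) (map (x ,_) ys) ++ pairs xs ys)
        ≡⟨ length-++ (filter (uncurry R?) (map (x ,_) ys)) ⟩
      length (filter (uncurry R?) (map (x ,_) ys)) + length (pairs xs ys)
        ≡⟨ cong (_+ length (pairs xs ys)) (row ys) ⟩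
      count (R? x) ys + length (pairs xs ys) ∎
      where
      open ≡-Reasoning
      row : ∀ ys → length (filter (uncurry R?) (map (x ,_) ys)) ≡ count (R? x) ys
      row []       = refl
      row (y ∷ ys) with does (R? x y)
      ... | true  = cong suc (row ys)
      ... | false = row ys

    -- The product is listed row by row, so a column is peeled off by induction on the rows; the
    -- sweep may shorten either list.
    length-pairs-∷ʳ : ∀ xs y ys →
      length (pairs xs (y ∷ ys)) ≡ count (flip R? y) xs + length (pairs xs ys)
    length-pairs-∷ʳ []       y ys = refl
    length-pairs-∷ʳ (x ∷ xs) y ys
      rewrite length-pairs-∷ x xs (y ∷ ys) | length-pairs-∷ x xs ys | length-pairs-∷ʳ xs y ys
      with does (R? x y)
    ... | true  = cong suc (+-exchange (count (R? x) ys) (count (flip R? y) xs) (length (pairs xs ys)))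
    ... | false = +-exchange (count (R? x) ys) (count (flip R? y) xs) (length (pairs xs ys))

    length-pairs-↭ˡ : ∀ {xs xs′} ys → xs ↭ xs′ → length (pairs xs ys) ≡ length (pairs xs′ ys)
    length-pairs-↭ˡ ys refl         = refl
    length-pairs-↭ˡ ys (prep {xs} {xs′} x p)
      rewrite length-pairs-∷ x xs ys | length-pairs-∷ x xs′ ys = cong (count (R? x) ys +_) (length-pairs-↭ˡ ys p)
    length-pairs-↭ˡ ys (swap {xs} {xs′} x y p)
      rewrite length-pairs-∷ x (y ∷ xs) ys | length-pairs-∷ y xs ys
            | length-pairs-∷ y (x ∷ xs′) ys | length-pairs-∷ x xs′ ys
            | length-pairs-↭ˡ ys p =
      +-exchange (count (R? x) ys) (count (R? y) ys) (length (pairs xs′ ys))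
    length-pairs-↭ˡ ys (trans p q)  = ≡.trans (length-pairs-↭ˡ ys p) (length-pairs-↭ˡ ys q)

    length-pairs-↭ʳ : ∀ xs {ys ys′} → ys ↭ ys′ → length (pairs xs ys) ≡ length (pairs xs ys′)
    length-pairs-↭ʳ []       p = refl
    length-pairs-↭ʳ (x ∷ xs) {ys} {ys′} p
      rewrite length-pairs-∷ x xs ys | length-pairs-∷ x xs ys′ =
      cong₂ _+_ (count-↭ (R? x) p) (length-pairs-↭ʳ xs p)

  -- Sweeping two families of intervals on a line.

  module Sweep {k ℓ₁ ℓ₂ : Level} (K : DecTotalOrder k ℓ₁ ℓ₂) where

    private module K = DecTotalOrder K
    open DecTotalOrder K using () renaming (Carrier to Key; _≤_ to _≼_; _≤?_ to _≼?_)

    -- The ends may come in the wrong order; such a pair encodes the empty interval.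
    Interval : Set k
    Interval = Key × Key

    lo hi : Interval → Key
    lo = proj₁
    hi = proj₂

    Nonempty : Interval → Set ℓ₂
    Nonempty I = lo I ≼ hi I

    _∋_ : Interval → Key → Set ℓ₂
    I ∋ z = lo I ≼ z × z ≼ hi I

    _∋?_ : Binary.Decidable _∋_
    I ∋? z = (lo I ≼? z) ×-dec (z ≼? hi I)

    -- With reversed ends both cross inequalities can still hold, so nonemptiness is required
    -- separately.
    Meets : Interval → Interval → Set ℓ₂
    Meets I J = (Nonempty I × Nonempty J) × lo I ≼ hi J × lo J ≼ hi I

    Meets? : Binary.Decidable Meets
    Meets? I J = ((_ ≼? _) ×-dec (_ ≼? _)) ×-dec (_ ≼? _) ×-dec (_ ≼? _)

    Meets-sym : ∀ I J → Meets I J → Meets J I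
    Meets-sym I J ((ne , ne′) , p , q) = (ne′ , ne) , q , p

    common⇒Meets : ∀ {I J z} → I ∋ z → J ∋ z → Meets I J
    common⇒Meets (p , q) (r , s) =
      (K.trans p q , K.trans r s) , K.trans p s , K.trans r q

    -- `J` starts no later than `hi I` because they meet, and ends no earlier by the assumed order
    -- of right ends.
    Meets⇒∋hi : ∀ {I J} → hi I ≼ hi J → Meets I J → J ∋ hi I
    Meets⇒∋hi I≼J (_ , _ , q) = q , I≼J

    -- Depth is tested only at `hi I`, the one point where the sweep uses it; an empty `I` imposes
    -- no bound.
    Depth≤ : ∀ {A : Set a} → (A → Interval) → List A → ℕ → Interval → Set ℓ₂
    Depth≤ f xs r I = Nonempty I → count (λ x → f x ∋? hi I) xs ≤ r

    Depth≤-tail : ∀ {A : Set a} (f : A → Interval) {x xs r I} →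
                  Depth≤ f (x ∷ xs) r I → Depth≤ f xs r I
    Depth≤-tail f {x} {xs} {I = I} d ne = ≤-trans (count-∷ (λ x → f x ∋? hi I) x xs) (d ne)

    module _ {A : Set a} (f : A → Interval) {I : Interval} {r : ℕ} where

      -- Every interval that meets `I` passes through `hi I`, where the depth is at most `r`; an
      -- empty `I` meets nothing.
      meets-bound : ∀ {xs} → All (λ x → hi I ≼ hi (f x)) xs → Depth≤ f xs r I →
                    count (λ x → Meets? I (f x)) xs ≤ r
      meets-bound {xs} I≼ d with lo I ≼? hi I
      ... | yes ne = ≤-trans (count-mono _ _ (All.map Meets⇒∋hi I≼)) (d ne)
      ... | no ¬ne = ≤-trans (≤-reflexive (cong length (filter-none _ {xs} none))) z≤n
        where
        none = All.map (λ _ m → ¬ne (proj₁ (proj₁ m))) I≼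

      apart-bound : ∀ {xs} → All (λ x → hi I ≼ hi (f x)) xs → Depth≤ f xs r I →
                    length xs ∸ r ≤ count (λ x → ¬? (Meets? I (f x))) xs
      apart-bound {xs} I≼ d = m≤n+o⇒m∸n≤o (length xs) r (begin
        length xs                              ≡⟨ count-∁ (λ x → Meets? I (f x)) xs ⟨
        count (λ x → Meets? I (f x)) xs + _    ≤⟨ +-monoˡ-≤ _ (meets-bound I≼ d) ⟩
        r + count (λ x → ¬? (Meets? I (f x))) xs ∎)
        where open ≤-Reasoning

    module _ {A : Set a} {B : Set b} (f : A → Interval) (g : B → Interval) where

      Apart? : Binary.Decidable (λ x y → ¬ Meets (f x) (g y))
      Apart? x y = ¬? (Meets? (f x) (g y))

      -- Of the two heads, the one with the smaller right end comes first among all remaining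
      -- intervals. By `apart-bound` it is apart from enough of the other family to pay for its
      -- removal.
      sweep-sorted : ∀ r s xs ys →
        AllPairs (λ x x′ → hi (f x) ≼ hi (f x′)) xs →
        AllPairs (λ y y′ → hi (g y) ≼ hi (g y′)) ys →
        All (Depth≤ g ys s ∘ f) xs → All (Depth≤ f xs r ∘ g) ys →
        (length xs ∸ r) * (length ys ∸ s) ≤ length (pairs Apart? xs ys)
      sweep-sorted r s [] ys _ _ _ _ rewrite 0∸n≡0 r = z≤n
      sweep-sorted r s xs@(_ ∷ _) [] _ _ _ _ rewrite 0∸n≡0 s | *-zeroʳ (length xs ∸ r) = z≤n
      sweep-sorted r s xs₀@(x ∷ xs) ys₀@(y ∷ ys) (x≼ ∷ ≼xs) (y≼ ∷ ≼ys) (dx ∷ dxs) (dy ∷ dys) =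
        [ (λ x≼y → begin
            -- When `r` exceeds `length xs`, the truncated difference stays `0`, hence only an
            -- inequality.
            (suc (length xs) ∸ r) * n                           ≤⟨ *-monoˡ-≤ n (1+m∸n≤1+[m∸n] (length xs) r) ⟩
            n + (length xs ∸ r) * n                             ≤⟨ +-mono-≤
              (apart-bound g (x≼y ∷ All.map (K.trans x≼y) y≼) dx)
              (sweep-sorted r s xs ys₀ ≼xs (y≼ ∷ ≼ys) dxs (All.map (Depth≤-tail f) (dy ∷ dys))) ⟩
            count (Apart? x) ys₀ + length (pairs Apart? xs ys₀) ≡⟨ length-pairs-∷ Apart? x xs ys₀ ⟨
            length (pairs Apart? xs₀ ys₀)                       ∎)
        , (λ y≼x → begin
            m * (suc (length ys) ∸ s)                           ≤⟨ *-monoʳ-≤ m (1+m∸n≤1+[m∸n] (length ys) s) ⟩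
            m * suc (length ys ∸ s)                             ≡⟨ *-suc m _ ⟩
            m + m * (length ys ∸ s)                             ≤⟨ +-mono-≤
              (≤-trans (apart-bound f (y≼x ∷ All.map (K.trans y≼x) x≼) dy)
                       (count-mono (λ x → ¬? (Meets? (g y) (f x))) (flip Apart? y)
                         (All.universal (λ x ¬m → ¬m ∘ Meets-sym (f x) (g y)) xs₀)))
              (sweep-sorted r s xs₀ ys (x≼ ∷ ≼xs) ≼ys (All.map (Depth≤-tail g) (dx ∷ dxs)) dys) ⟩
            count (flip Apart? y) xs₀ + length (pairs Apart? xs₀ ys) ≡⟨ length-pairs-∷ʳ Apart? xs₀ y ys ⟨
            length (pairs Apart? xs₀ ys₀)                       ∎)
        ]′ (K.total (hi (f x)) (hi (g y)))
        where
        open ≤-Reasoning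
        m = length xs₀ ∸ r
        n = length ys₀ ∸ s

      -- Depths and numbers of pairs are invariant under permutation, so both lists may be sorted by
      -- right end.
      sweep : ∀ r s xs ys → All (Depth≤ g ys s ∘ f) xs → All (Depth≤ f xs r ∘ g) ys →
              (length xs ∸ r) * (length ys ∸ s) ≤ length (pairs Apart? xs ys)
      sweep r s xs ys dxs dys = begin
        (length xs ∸ r) * (length ys ∸ s)     ≡⟨ cong₂ (λ m n → (m ∸ r) * (n ∸ s)) (↭-length xs↭) (↭-length ys↭) ⟨
        (length xs′ ∸ r) * (length ys′ ∸ s)   ≤⟨ sweep-sorted r s xs′ ys′
          (Linked.Linked⇒AllPairs K.trans (F.sort-↗ xs)) (Linked.Linked⇒AllPairs K.trans (G.sort-↗ ys))
          (All-resp-↭ (↭-sym xs↭) (All.map (λ d ne → ≤-trans (≤-reflexive (count-↭ _ ys↭)) (d ne)) dxs))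
          (All-resp-↭ (↭-sym ys↭) (All.map (λ d ne → ≤-trans (≤-reflexive (count-↭ _ xs↭)) (d ne)) dys)) ⟩
        length (pairs Apart? xs′ ys′)         ≡⟨ length-pairs-↭ˡ Apart? ys′ xs↭ ⟩
        length (pairs Apart? xs ys′)          ≡⟨ length-pairs-↭ʳ Apart? xs ys↭ ⟩
        length (pairs Apart? xs ys)           ∎
        where
        open ≤-Reasoning
        module F = Sort (On.decTotalOrder K (hi ∘ f))
        module G = Sort (On.decTotalOrder K (hi ∘ g))
        xs′ = F.sort xs
        ys′ = G.sort ys
        xs↭ = F.sort-↭ xs
        ys↭ = G.sort-↭ ys

  -- Finite products and codes of tuples.

  ∏ : ∀ {n} → (Fin n → ℕ) → ℕ
  ∏ f = product (tabulate f)

  ∏-++ : ∀ m {n} (h : Fin (m + n) → ℕ) → ∏ h ≡ ∏ (h ∘ (_↑ˡ n)) * ∏ (h ∘ (m ↑ʳ_))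
  ∏-++ zero    h = ≡.sym (*-identityˡ _)
  ∏-++ (suc m) h = ≡.trans (cong (h zero *_) (∏-++ m (h ∘ suc))) (≡.sym (*-assoc (h zero) _ _))

  ∏-* : ∀ {n} (f g : Fin n → ℕ) → ∏ f * ∏ g ≡ ∏ (λ i → f i * g i)
  ∏-* {zero}  f g = refl
  ∏-* {suc n} f g = ≡.trans (*-interchange (f zero) _ (g zero) _)
    (cong (f zero * g zero *_) (∏-* (f ∘ suc) (g ∘ suc)))

  ∏-mono-≤ : ∀ {n} {f g : Fin n → ℕ} → (∀ i → f i ≤ g i) → ∏ f ≤ ∏ g
  ∏-mono-≤ {zero}  f≤g = ≤-refl
  ∏-mono-≤ {suc n} f≤g = *-mono-≤ (f≤g zero) (∏-mono-≤ (f≤g ∘ suc))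

  -- `combine zero l` is index `l` and `combine (suc zero) l` is index `l + d`, so the factors are
  -- grouped by line.
  ∏-halves : ∀ d (h : Fin (2 * d) → ℕ) →
             ∏ h ≡ ∏ (λ l → h (combine {2} {d} zero l) * h (combine {2} {d} (suc zero) l))
  ∏-halves d h = begin
    ∏ h                             ≡⟨ ∏-++ d h ⟩
    ∏ left * ∏ (λ i → h (d ↑ʳ i))   ≡⟨ cong (∏ left *_) (∏-++ d (λ i → h (d ↑ʳ i))) ⟩
    -- `2 * d` unfolds to `d + (d + 0)`; the factor `1` is the empty product over the last summand.
    ∏ left * (∏ right * 1)          ≡⟨ cong (∏ left *_) (*-identityʳ (∏ right)) ⟩
    ∏ left * ∏ right                ≡⟨ ∏-* left right ⟩
    ∏ (λ l → left l * right l)      ∎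
    where
    open ≡-Reasoning
    left right : Fin d → ℕ
    left  l = h (combine {2} zero l)
    right l = h (combine {2} (suc zero) l)

  uncurry-combine-injective : ∀ {a b} (x y : Fin a × Fin b) →
                              uncurry combine x ≡ uncurry combine y → x ≡ y
  uncurry-combine-injective (i , j) (k , l) eq with refl , refl ← Fin.combine-injective i j k l eq = refl

  -- Mixed-radix code. Tuples are functions compared pointwise; as numbers below `∏ N` they can be
  -- counted by pigeonhole.
  encode : ∀ {d} {N : Fin d → ℕ} → (∀ l → Fin (N l)) → Fin (∏ N)
  encode {zero}  t = zero
  encode {suc d} t = combine (t zero) (encode (t ∘ suc))

  encode-injective : ∀ {d} {N : Fin d → ℕ} (s t : ∀ l → Fin (N l)) →
                     encode s ≡ encode t → ∀ l → s l ≡ t l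
  encode-injective s t eq zero    = Fin.combine-injectiveˡ (s zero) _ (t zero) _ eq
  encode-injective s t eq (suc l) =
    encode-injective (s ∘ suc) (t ∘ suc) (Fin.combine-injectiveʳ (s zero) _ (t zero) _ eq) l

  codes : ∀ {d} {N : Fin d → ℕ} → (∀ l → List (Fin (N l))) → List (Fin (∏ N))
  codes {zero}  L = zero ∷ []
  codes {suc d} L = cartesianProductWith combine (L zero) (codes (L ∘ suc))

  codes-unique : ∀ {d} {N : Fin d → ℕ} (L : ∀ l → List (Fin (N l))) →
                 (∀ l → Unique (L l)) → Unique (codes L)
  codes-unique {zero}  L L! = [] ∷ []
  codes-unique {suc d} L L! = Unique.cartesianProductWith⁺ combine
    (λ {a} {b} {c} {d} → Fin.combine-injective a c b d) (L! zero) (codes-unique (L ∘ suc) (L! ∘ suc))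

  length-cartesianProductWith : ∀ {C : Set p} (f : A → B → C) xs ys →
    length (cartesianProductWith f xs ys) ≡ length xs * length ys
  length-cartesianProductWith f []       ys = refl
  length-cartesianProductWith f (x ∷ xs) ys = ≡.trans (length-++ (map (f x) ys))
    (cong₂ _+_ (length-map (f x) ys) (length-cartesianProductWith f xs ys))

  length-codes : ∀ {d} {N : Fin d → ℕ} (L : ∀ l → List (Fin (N l))) →
                 length (codes L) ≡ ∏ (λ l → length (L l))
  length-codes {zero}  L = refl
  length-codes {suc d} L = ≡.trans (length-cartesianProductWith combine (L zero) _)
    (cong (length (L zero) *_) (length-codes (L ∘ suc)))

  encode∈codes⁻ : ∀ {d} {N : Fin d → ℕ} (L : ∀ l → List (Fin (N l))) t →
                  encode t ∈ˡ codes L → ∀ l → t l ∈ˡ L l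
  encode∈codes⁻ {suc d} L t t∈ l
    with a , c , a∈ , c∈ , eq ← ∈-cartesianProductWith⁻ combine (L zero) (codes (L ∘ suc)) t∈
    with refl , refl ← Fin.combine-injective (t zero) _ a c eq
    with l
  ... | zero  = a∈
  ... | suc l = encode∈codes⁻ (L ∘ suc) (t ∘ suc) c∈ l

  lookup-injective : ∀ {xs : List A} → Unique xs → ∀ {i j} → lookup xs i ≡ lookup xs j → i ≡ j
  lookup-injective (_ ∷ _)    {zero}  {zero}  eq = refl
  lookup-injective (x∉ ∷ _)   {zero}  {suc j} eq = contradiction eq (All.lookup x∉ (∈-lookup j))
  lookup-injective (x∉ ∷ _)   {suc i} {zero}  eq = contradiction (sym eq) (All.lookup x∉ (∈-lookup i))
  lookup-injective (_ ∷ xs!)  {suc i} {suc j} eq = cong suc (lookup-injective xs! eq)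

  unique-length : ∀ {n} {xs : List (Fin n)} → Unique xs → length xs ≤ n
  unique-length xs! = Fin.injective⇒≤ (lookup-injective xs!)

  -- The codes of `ts` and those of the box with sides `L l` are disjoint and repetition-free, so
  -- together they fit into `Fin (∏ N)`.
  tuples-bound : ∀ {d} {N : Fin d → ℕ} (L : ∀ l → List (Fin (N l))) → (∀ l → Unique (L l)) →
    ∀ {ts : List (∀ l → Fin (N l))} → AllPairs (λ s t → ¬ (∀ l → s l ≡ t l)) ts →
    All (λ t → ¬ (∀ l → t l ∈ˡ L l)) ts → length ts + ∏ (λ l → length (L l)) ≤ ∏ N
  tuples-bound {N = N} L L! {ts} ts! ts∉ = begin
    length ts + ∏ (λ l → length (L l))         ≡⟨ cong₂ _+_ (length-map encode ts) (length-codes L) ⟨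
    length (map encode ts) + length (codes L)  ≡⟨ length-++ (map encode ts) ⟨
    length (map encode ts ++ codes L)          ≤⟨ unique-length (Unique.++⁺
      (AllPairs.map⁺ (AllPairs.map (λ {s} {t} s≠t eq → s≠t (encode-injective s t eq)) ts!))
      (codes-unique L L!) (disjoint ts∉)) ⟩
    ∏ N                                        ∎
    where
    open ≤-Reasoning
    disjoint : ∀ {ts} → All (λ t → ¬ (∀ l → t l ∈ˡ L l)) ts →
               ∀ {c} → ¬ (c ∈ˡ map encode ts × c ∈ˡ codes L)
    disjoint (t∉ ∷ _)  (here refl , c∈) = t∉ (encode∈codes⁻ L _ c∈)
    disjoint (_ ∷ ts∉) (there c∈ , c∈′) = disjoint ts∉ (c∈ , c∈′)

open Combinatorics

-- Subsets of `Fin n` from decidable predicates.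

module _ {p : Level} where

  subset : ∀ {n} {P : Pred (Fin n) p} → Decidable P → Subset n
  subset P? = Vec.tabulate (does ∘ P?)

  ∣subset∣ : ∀ {m n} {P : Pred (Fin m) p} (P? : Decidable P) (f : Fin n → Fin m) →
             ∣ subset (P? ∘ f) ∣ ≡ count P? (List.tabulate f)
  ∣subset∣ {n = zero}  P? f = refl
  ∣subset∣ {n = suc n} P? f with does (P? (f zero))
  ... | true  = ≡.cong suc (∣subset∣ P? (f ∘ suc))
  ... | false = ∣subset∣ P? (f ∘ suc)

  ∈subset⁻ : ∀ {n} {P : Pred (Fin n) p} (P? : Decidable P) {i} → i ∈ subset P? → P i
  ∈subset⁻ P? {i} i∈ = does⇒ (P? i)
    (≡.trans (≡.sym (Vec.lookup∘tabulate (does ∘ P?) i)) (Vec.[]=⇒lookup i∈))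
    where
    does⇒ : ∀ {Q : Set p} (Q? : Dec Q) → does Q? ≡ true → Q
    does⇒ (yes q) _ = q

map-proj₁-toList : ∀ {a p} {A : Set a} {P : Pred A p} {xs : List A} (pxs : All P xs) →
                   List.map proj₁ (All.toList pxs) ≡ xs
map-proj₁-toList []         = refl
map-proj₁-toList (px ∷ pxs) = ≡.cong (_ ∷_) (map-proj₁-toList pxs)

-- Arithmetic in the ordered field.

module OrderedField {ℓ : Level} (ℝ : CompleteOrderedField ℓ) where

  open CompleteOrderedField ℝ hiding (zero)
  open RingProperties ring

  decTotalOrder : DecTotalOrder ℓ ℓ ℓ
  decTotalOrder = record { isDecTotalOrder = isDecTotalOrder }

  private module ≤ = DecTotalOrder decTotalOrder
  open PreorderReasoning ≤.preorder using (begin_; step-≲; step-≈; step-≈-⟩; step-≈-⟨; _∎)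

  +-monoˡ-≤ : ∀ {x y} z → x ≤ y → x + z ≤ y + z
  +-monoˡ-≤ {x} {y} z x≤y = begin
    x + z ≈⟨ +-comm x z ⟩
    z + x ≲⟨ +-monoʳ-≤ z x≤y ⟩
    z + y ≈⟨ +-comm z y ⟩
    y + z ∎

  +-cancelˡ-≤ : ∀ x {y z} → x + y ≤ x + z → y ≤ z
  +-cancelˡ-≤ x {y} {z} h = begin
    y             ≈⟨ \\-leftDividesʳ x y ⟨
    - x + (x + y) ≲⟨ +-monoʳ-≤ (- x) h ⟩
    - x + (x + z) ≈⟨ \\-leftDividesʳ x z ⟩
    z             ∎

  x≤y⇒0≤y-x : ∀ {x y} → x ≤ y → 0# ≤ y - x
  x≤y⇒0≤y-x {x} {y} x≤y = begin
    0#    ≈⟨ -‿inverseʳ x ⟨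
    x - x ≲⟨ +-monoˡ-≤ (- x) x≤y ⟩
    y - x ∎

  0≤y-x⇒x≤y : ∀ {x y} → 0# ≤ y - x → x ≤ y
  0≤y-x⇒x≤y {x} {y} h = begin
    x           ≈⟨ +-identityˡ x ⟨
    0# + x      ≲⟨ +-monoˡ-≤ x h ⟩
    (y - x) + x ≈⟨ //-rightDividesˡ x y ⟩
    y           ∎

  *-monoʳ-≤ : ∀ {x y z} → 0# ≤ x → y ≤ z → x * y ≤ x * z
  *-monoʳ-≤ {x} {y} {z} 0≤x y≤z = 0≤y-x⇒x≤y (begin
    0#            ≲⟨ *-nonNeg 0≤x (x≤y⇒0≤y-x y≤z) ⟩
    x * (z - y)   ≈⟨ x[y-z]≈xy-xz x z y ⟩
    x * z - x * y ∎)

  *-zero-divisor-free : ∀ {x y} → ¬ y ≈ 0# → x * y ≈ 0# → x ≈ 0#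
  *-zero-divisor-free {x} {y} y≉0 xy≈0 =
    trans (sym (*-identityʳ x)) (trans (*-congˡ (sym yw≈1)) (trans (sym (*-assoc x y w))
      (trans (*-congʳ xy≈0) (zeroˡ w))))
    where
    w    = proj₁ (*-inverse y≉0)
    yw≈1 = proj₂ (*-inverse y≉0)

  ≰⇒≥ : ∀ {x y} → ¬ x ≤ y → y ≤ x
  ≰⇒≥ {x} {y} x≰y = [ flip contradiction x≰y , (λ y≤x → y≤x) ]′ (≤.total x y)

  -- Positivity is written `¬ z ≤ 0#`. If `x ≤ y` failed, `(x - y) * z` would be both nonnegative
  -- and at most `0#`, hence zero, and cancelling `z` would give `x ≈ y`.
  *-cancelʳ-≤ : ∀ {x y z} → ¬ z ≤ 0# → x * z ≤ y * z → x ≤ y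
  *-cancelʳ-≤ {x} {y} {z} z≰0 xz≤yz with x ≤.≤? y
  ... | yes x≤y = x≤y
  ... | no  x≰y = ≤.reflexive (x∙y⁻¹≈ε⇒x≈y x y (*-zero-divisor-free (z≰0 ∘ ≤.reflexive) (≤.antisym
    (begin
      (x - y) * z   ≈⟨ [y-z]x≈yx-zx z x y ⟩
      x * z - y * z ≲⟨ +-monoˡ-≤ _ xz≤yz ⟩
      y * z - y * z ≈⟨ -‿inverseʳ _ ⟩
      0#            ∎)
    (*-nonNeg (x≤y⇒0≤y-x (≰⇒≥ x≰y)) (≰⇒≥ z≰0)))))

  *-pos : ∀ {x y} → ¬ x ≤ 0# → ¬ y ≤ 0# → ¬ x * y ≤ 0#
  *-pos x≰0 y≰0 xy≤0 = x≰0 (*-cancelʳ-≤ y≰0 (≤.trans xy≤0 (≤.reflexive (sym (zeroˡ _)))))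

  0≤1 : 0# ≤ 1#
  0≤1 = [ (λ 0≤1 → 0≤1) , (λ 1≤0 → begin
    0#            ≲⟨ *-nonNeg (0≤-1 1≤0) (0≤-1 1≤0) ⟩
    - 1# * - 1#   ≈⟨ -1*x≈-x (- 1#) ⟩
    - - 1#        ≈⟨ -‿involutive 1# ⟩
    1#            ∎) ]′ (≤.total 0# 1#)
    where
    0≤-1 : 1# ≤ 0# → 0# ≤ - 1#
    0≤-1 1≤0 = ≤.trans (x≤y⇒0≤y-x 1≤0) (≤.reflexive (+-identityˡ _))

  1≰0 : ¬ 1# ≤ 0#
  1≰0 1≤0 = 0≉1 (≤.antisym 0≤1 1≤0)

  fromℕ-+ : ∀ m n → fromℕ (m ℕ.+ n) ≈ fromℕ m + fromℕ n
  fromℕ-+ = MonoidMult.×-homo-+ +-monoid 1#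

  fromℕ-* : ∀ m n → fromℕ (m ℕ.* n) ≈ fromℕ m * fromℕ n
  fromℕ-* = SemiringMult.×1-homo-* semiring

  fromℕ-nonNeg : ∀ n → 0# ≤ fromℕ n
  fromℕ-nonNeg zero    = ≤.refl
  fromℕ-nonNeg (suc n) = begin
    0#           ≲⟨ fromℕ-nonNeg n ⟩
    fromℕ n      ≈⟨ +-identityˡ (fromℕ n) ⟨
    0# + fromℕ n ≲⟨ +-monoˡ-≤ (fromℕ n) 0≤1 ⟩
    1# + fromℕ n ∎

  fromℕ-mono-≤ : ∀ {m n} → m ℕ.≤ n → fromℕ m ≤ fromℕ n
  fromℕ-mono-≤ {n = n} z≤n = fromℕ-nonNeg n
  fromℕ-mono-≤ (s≤s m≤n) = +-monoʳ-≤ 1# (fromℕ-mono-≤ m≤n)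

  partition : ∀ {x y} z → x + y ≈ 1# → x * z + y * z ≈ z
  partition {x} {y} z x+y≈1 =
    trans (sym (distribʳ z x y)) (trans (*-congʳ x+y≈1) (*-identityˡ z))

  -- Strictness, stated as a negated `≤`, comes from the first factor; the others only need the weak
  -- inequality, by mutual recursion. For `n = 0` both sides equal one, hence `1 ≤ n`.
  ∏-strict : ∀ {γ} → 0# ≤ γ → ∀ {n} → 1 ℕ.≤ n → (f g : Fin n → ℕ) →
             (∀ i → ¬ fromℕ (g i) ≤ γ * fromℕ (f i)) →
             ¬ fromℕ (∏ g) ≤ γ ^ n * fromℕ (∏ f)
  -- The tail product of `g` is positive because each factor exceeds a nonnegative number, so it can
  -- be cancelled.
  ∏-strict {γ} 0≤γ {suc n} _ f g f<g h = f<g zero (*-cancelʳ-≤ (pos n (g ∘ suc) pos-g) (begin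
    fromℕ (g zero) * fromℕ (∏ (g ∘ suc))                     ≈⟨ fromℕ-* (g zero) _ ⟨
    fromℕ (∏ g)                                              ≲⟨ h ⟩
    γ ^ suc n * fromℕ (∏ f)                                  ≈⟨ *-congˡ (fromℕ-* (f zero) _) ⟩
    (γ * γ ^ n) * (fromℕ (f zero) * fromℕ (∏ (f ∘ suc)))     ≈⟨ interchange _ _ _ _ ⟩
    (γ * fromℕ (f zero)) * (γ ^ n * fromℕ (∏ (f ∘ suc)))     ≲⟨ *-monoʳ-≤ (0≤γf zero)
      (weak n (f ∘ suc) (g ∘ suc) (f<g ∘ suc)) ⟩
    (γ * fromℕ (f zero)) * fromℕ (∏ (g ∘ suc))               ∎))
    where
    open CommutativeSemigroup *-commutativeSemigroup using (interchange)
    0≤γf : ∀ i → 0# ≤ γ * fromℕ (f i)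
    0≤γf i = *-nonNeg 0≤γ (fromℕ-nonNeg (f i))
    pos-g : ∀ i → ¬ fromℕ (g (suc i)) ≤ 0#
    pos-g i g≤0 = f<g (suc i) (≤.trans g≤0 (0≤γf (suc i)))
    pos : ∀ n (g : Fin n → ℕ) → (∀ i → ¬ fromℕ (g i) ≤ 0#) → ¬ fromℕ (∏ g) ≤ 0#
    pos zero    g g>0 h = 1≰0 (≤.trans (≤.reflexive (sym (+-identityʳ 1#))) h)
    pos (suc n) g g>0 h = *-pos (g>0 zero) (pos n (g ∘ suc) (g>0 ∘ suc))
      (≤.trans (≤.reflexive (sym (fromℕ-* (g zero) _))) h)
    weak : ∀ n (f g : Fin n → ℕ) → (∀ i → ¬ fromℕ (g i) ≤ γ * fromℕ (f i)) →
           γ ^ n * fromℕ (∏ f) ≤ fromℕ (∏ g)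
    weak zero    f g f<g = ≤.reflexive (*-identityˡ _)
    weak (suc n) f g f<g = ≰⇒≥ (∏-strict 0≤γ (s≤s z≤n) f g f<g)

  -- Convexity speaks of weighted means, so `z` is written as the mean of `x` and `y` with weight
  -- `(z - x) / (y - x)` on `y`.
  between : ∀ {S : Pred Carrier ℓ} → S Respects _≈_ →
            (∀ {x y t} → S x → S y → 0# ≤ t → t ≤ 1# → S ((1# - t) * x + t * y)) →
            ∀ {x y z} → S x → S y → x ≤ z → z ≤ y → S z
  between resp conv {x} {y} {z} Sx Sy x≤z z≤y with (y - x) ≤.≤? 0#
  -- The segment degenerates and no division is possible: `x`, `z` and `y` coincide.
  ... | yes y-x≤0 = resp (≤.antisym x≤z (≤.trans z≤y y≤x)) Sx
    where
    y≤x : y ≤ x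
    y≤x = begin
      y           ≈⟨ //-rightDividesˡ x y ⟨
      (y - x) + x ≲⟨ +-monoˡ-≤ x y-x≤0 ⟩
      0# + x      ≈⟨ +-identityˡ x ⟩
      x           ∎
  ... | no  y-x≰0 = resp z≈ (conv Sx Sy 0≤t t≤1)
    where
    w = proj₁ (*-inverse (y-x≰0 ∘ ≤.reflexive))
    t = (z - x) * w
    t[y-x]≈z-x : t * (y - x) ≈ z - x
    t[y-x]≈z-x = trans (*-assoc _ w _) (trans (*-congˡ (trans (*-comm w _)
      (proj₂ (*-inverse (y-x≰0 ∘ ≤.reflexive))))) (*-identityʳ _))
    0≤t : 0# ≤ t
    0≤t = *-cancelʳ-≤ y-x≰0 (begin
      0# * (y - x) ≈⟨ zeroˡ _ ⟩
      0#           ≲⟨ x≤y⇒0≤y-x x≤z ⟩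
      z - x        ≈⟨ t[y-x]≈z-x ⟨
      t * (y - x)  ∎)
    t≤1 : t ≤ 1#
    t≤1 = *-cancelʳ-≤ y-x≰0 (begin
      t * (y - x)  ≈⟨ t[y-x]≈z-x ⟩
      z - x        ≲⟨ +-monoˡ-≤ (- x) z≤y ⟩
      y - x        ≈⟨ *-identityˡ _ ⟨
      1# * (y - x) ∎)
    module ≈ = SetoidReasoning setoid
    z≈ : (1# - t) * x + t * y ≈ z
    z≈ = ≈.begin
      (1# - t) * x + t * y       ≈.≈⟨ +-congʳ ([y-z]x≈yx-zx x 1# t) ⟩
      (1# * x - t * x) + t * y   ≈.≈⟨ +-congʳ (+-congʳ (*-identityˡ x)) ⟩
      (x - t * x) + t * y        ≈.≈⟨ +-assoc x _ _ ⟩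
      x + (- (t * x) + t * y)    ≈.≈⟨ +-congˡ (+-comm _ _) ⟩
      x + (t * y - t * x)        ≈.≈⟨ +-congˡ (x[y-z]≈xy-xz t y x) ⟨
      x + t * (y - x)            ≈.≈⟨ +-congˡ t[y-x]≈z-x ⟩
      x + (z - x)                ≈.≈⟨ +-comm x _ ⟩
      (z - x) + x                ≈.≈⟨ //-rightDividesˡ x z ⟩
      z                          ≈.∎

-- Hulls of finite lists of reals.

module Hull {ℓ : Level} (ℝ : CompleteOrderedField ℓ) where

  open CompleteOrderedField ℝ using (0#; 1#)
  open OrderedField ℝ using (decTotalOrder; 1≰0)
  open Sweep decTotalOrder
  open DecTotalOrder decTotalOrder using (totalOrder; Carrier)
  open Extrema totalOrder

  -- The hull of the empty list is an interval with its ends in the wrong order.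
  hull : List Carrier → Interval
  hull []       = 1# , 0#
  hull (x ∷ xs) = min x xs , max x xs

  ∈⇒hull∋ : ∀ {x xs} → x ∈ˡ xs → hull xs ∋ x
  ∈⇒hull∋ {xs = x ∷ xs} (here refl) = min≤⊤ x xs , ⊥≤max x xs
  ∈⇒hull∋ {xs = x ∷ xs} (there y∈)  = All.lookup (min≤xs x xs) y∈ , All.lookup (xs≤max x xs) y∈

  -- Minimum and maximum are attained in the list, so facts about listed numbers apply at the ends
  -- of the hull. Nonemptiness rules out the empty list, since `1# ≤ 0#` is false.
  lo∈ : ∀ xs → Nonempty (hull xs) → lo (hull xs) ∈ˡ xs
  lo∈ []       ne = contradiction ne 1≰0
  lo∈ (x ∷ xs) ne = [ here , there ]′ (argmin-sel _ x xs)

  hi∈ : ∀ xs → Nonempty (hull xs) → hi (hull xs) ∈ˡ xs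
  hi∈ []       ne = contradiction ne 1≰0
  hi∈ (x ∷ xs) ne = [ here , there ]′ (argmax-sel _ x xs)

-- Traces of the members on the lines and their depths.

module Incidences {ℓ : Level} (ℝ : CompleteOrderedField ℓ) (d : ℕ)
  {P : Pred (DIntervals.Point ℝ d) ℓ} {m : ℕ} (C : Fin m → DIntervals.FiniteSubfamily ℝ d P)
  (qs : List (∃ (DIntervals.Intersecting ℝ d C))) where

  open CompleteOrderedField ℝ using (Carrier)
  open DIntervals ℝ d
  open FiniteSubfamily
  open OrderedField ℝ using (decTotalOrder; between)
  open Sweep decTotalOrder
  open Hull ℝ

  tuple : ∃ (Intersecting C) → ColorfulTuple C
  tuple = proj₁

  point : ∃ (Intersecting C) → Point
  point q = proj₁ (proj₂ q)

  Witnesses : ∀ i → Fin d → Fin (size (C i)) → Pred (∃ (Intersecting C)) _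
  Witnesses i l a q = proj₂ (point q) ≡ l × tuple q i ≡ a

  witnesses? : ∀ i l a → Decidable (Witnesses i l a)
  witnesses? i l a q = (proj₂ (point q) Fin.≟ l) ×-dec (tuple q i Fin.≟ a)

  coordinates : ∀ i → Fin d → Fin (size (C i)) → List Carrier
  coordinates i l a = List.map (proj₁ ∘ point) (List.filter (witnesses? i l a) qs)

  -- Membership in members of C is undecidable; their trace on line l is replaced
  -- by the hull of the finitely many points known to lie in it.
  trace : ∀ i → Fin d → Fin (size (C i)) → Interval
  trace i l a = hull (coordinates i l a)

  coordinates⁻ : ∀ i l a {z} → z ∈ˡ coordinates i l a →
                 ∃ λ q → q ∈ˡ qs × point q ≡ (z , l) × tuple q i ≡ a
  coordinates⁻ i l a z∈ with q , q∈ , refl , refl , eq ← ∈-map∘filter⁻ (proj₁ ∘ point) (witnesses? i l a) z∈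
    = q , q∈ , refl , eq

  -- Passing to traces keeps every listed intersection: the chosen point of `q` is itself among the
  -- coordinates that span the trace.
  trace∋ : ∀ i {q} → q ∈ˡ qs → trace i (proj₂ (point q)) (tuple q i) ∋ proj₁ (point q)
  trace∋ i {q} q∈ = ∈⇒hull∋ (∈-map∘filter⁺ (proj₁ ∘ point) (witnesses? i _ _) (q , q∈ , refl , refl , refl))

  coordinate⇒member : ∀ i l a {z} → z ∈ˡ coordinates i l a → member (C i) a (z , l)
  coordinate⇒member i l a z∈ with q , _ , refl , refl ← coordinates⁻ i l a z∈ = proj₂ (proj₂ q) i

  -- The ends of the trace are points of the member, so convexity puts everything between them into
  -- the underlying `d`-interval; `P (z , l)` then gives membership.
  trace⇒member : ∀ i l a {z} → P (z , l) → trace i l a ∋ z → member (C i) a (z , l)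
  trace⇒member i l a Pz (lo≤z , z≤hi) with I , C⊆ , ⊆C ← member∈ (C i) a =
    ⊆C (between (DInterval.respects I l) (DInterval.convex I l)
         (proj₁ (C⊆ (coordinate⇒member i l a (lo∈ _ ne))))
         (proj₁ (C⊆ (coordinate⇒member i l a (hi∈ _ ne)))) lo≤z z≤hi , Pz)
    where ne = DecTotalOrder.trans decTotalOrder lo≤z z≤hi

  depth : ∀ i → Point → ℕ
  depth i (z , l) = count (λ a → trace i l a ∋? z) (allFin (size (C i)))

  -- Only the listed points are examined; this suffices because right ends of nonempty traces are
  -- among them. For empty `qs` the value is `0`.
  maxDepth : Fin m → ℕ
  maxDepth i = ℕExtrema.max 0 (List.map (depth i ∘ point) qs)

  depth≤maxDepth : ∀ i {q} → q ∈ˡ qs → depth i (point q) ℕ.≤ maxDepth i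
  depth≤maxDepth i q∈ = All.lookup (ℕExtrema.xs≤max 0 _) (∈-map⁺ (depth i ∘ point) q∈)

  -- Depth counts traces; since traces within `P` lie in their members, it yields members with a
  -- genuine common point.
  depth-attained : ∀ i {q} → q ∈ˡ qs → ∃ λ (D : Subset (size (C i))) →
    ∣ D ∣ ≡ depth i (point q) × (∃ λ p → ∀ {a} → a ∈ D → member (C i) a p)
  depth-attained i {q@(t , p@(z , l) , p∈)} q∈ =
    subset stabs? , ∣subset∣ stabs? (λ a → a) , p , λ a∈ → trace⇒member i l _ Pp (∈subset⁻ stabs? a∈)
    where
    stabs? : Decidable (λ a → trace i l a ∋ z)
    stabs? a = trace i l a ∋? z
    Pp : P p
    -- `p` lies in `P` because it lies in `member (C i) (t i)`, a subset of `P`.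
    Pp = proj₂ (proj₁ (proj₂ (member∈ (C i) (t i))) (p∈ i))

  maxDepth-attained : Point → ∀ i → ∃ λ (D : Subset (size (C i))) →
    ∣ D ∣ ≡ maxDepth i × (∃ λ p → ∀ {a} → a ∈ D → member (C i) a p)
  maxDepth-attained p₀ i with ℕExtrema.argmax-sel (λ n → n) 0 (List.map (depth i ∘ point) qs)
  -- A maximum equal to the default `0` is realised by the empty subfamily, for which any point `p₀`
  -- serves.
  ... | inj₁ max≡0 = ⊥ , ≡.trans (∣⊥∣≡0 (size (C i))) (≡.sym max≡0) , p₀ , λ a∈⊥ → contradiction a∈⊥ ∉⊥
  ... | inj₂ max∈ with q , q∈ , max≡ ← ∈-map⁻ (depth i ∘ point) max∈
                  with D , ∣D∣≡ , stabbed ← depth-attained i q∈ =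
    D , ≡.trans ∣D∣≡ (≡.sym max≡) , stabbed

  -- The right end of a nonempty trace is the coordinate of a listed point on line `l`, where the
  -- depth is at most the maximum.
  trace-depth : ∀ i j l a → Depth≤ (trace j l) (allFin (size (C j))) (maxDepth j) (trace i l a)
  trace-depth i j l a ne with q , q∈ , eq , _ ← coordinates⁻ i l a (hi∈ _ ne) =
    ℕ.≤-trans (ℕ.≤-reflexive (≡.cong (depth j) (≡.sym eq))) (depth≤maxDepth j q∈)

  apartPairs : ∀ i j (l : Fin d) → List (Fin (size (C i)) × Fin (size (C j)))
  apartPairs i j l = pairs (Apart? (trace i l) (trace j l)) (allFin (size (C i))) (allFin (size (C j)))

  length-apartPairs : ∀ i j l →
    (size (C i) ℕ.∸ maxDepth i) ℕ.* (size (C j) ℕ.∸ maxDepth j) ℕ.≤ length (apartPairs i j l)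
  length-apartPairs i j l =
    ≡.subst₂ (λ a b → (a ℕ.∸ maxDepth i) ℕ.* (b ℕ.∸ maxDepth j) ℕ.≤ length (apartPairs i j l))
      (length-tabulate {n = size (C i)} (λ a → a)) (length-tabulate {n = size (C j)} (λ a → a))
      (sweep (trace i l) (trace j l) (maxDepth i) (maxDepth j) (allFin _) (allFin _)
        (All.universal (trace-depth i j l) _) (All.universal (trace-depth j i l) _))

  apart⇒not-both : ∀ i j {q} → q ∈ˡ qs →
    ¬ (tuple q i , tuple q j) ∈ˡ apartPairs i j (proj₂ (point q))
  apart⇒not-both i j q∈ pair∈ =
    proj₂ (∈-filter⁻ (uncurry (Apart? (trace i _) (trace j _))) {xs = List.cartesianProduct (allFin _) (allFin _)} pair∈)
      (common⇒Meets (trace∋ i q∈) (trace∋ j q∈))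

-- Counting tuples whose pairs are apart on every line.

module Counting {ℓ : Level} (ℝ : CompleteOrderedField ℓ) (d : ℕ)
  {P : Pred (DIntervals.Point ℝ d) ℓ} (C : Fin (2 ℕ.* d) → DIntervals.FiniteSubfamily ℝ d P)
  (qs : List (∃ (DIntervals.Intersecting ℝ d C))) where

  open DIntervals ℝ d
  open FiniteSubfamily
  open Incidences ℝ d C qs

  fst snd : Fin d → Fin (2 ℕ.* d)
  fst = combine {2} zero
  snd = combine {2} (suc zero)

  n : Fin (2 ℕ.* d) → ℕ
  n i = size (C i)

  rest : Fin (2 ℕ.* d) → ℕ
  rest i = n i ℕ.∸ maxDepth i

  -- Grouping by line turns the tuples whose pairs are all apart into a box, so their number is a
  -- product over the lines.
  pairUp : ColorfulTuple C → ∀ l → Fin (n (fst l) ℕ.* n (snd l))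
  pairUp t l = combine (t (fst l)) (t (snd l))

  pairUp-injective : ∀ s t → (∀ l → pairUp s l ≡ pairUp t l) → ∀ i → s i ≡ t i
  pairUp-injective s t eq i with Fin.combine-surjective {2} {d} i
  ... | zero     , l , refl = proj₁ (Fin.combine-injective (s (fst l)) _ _ _ (eq l))
  ... | suc zero , l , refl = proj₂ (Fin.combine-injective (s (fst l)) _ _ _ (eq l))

  apartCodes : ∀ l → List (Fin (n (fst l) ℕ.* n (snd l)))
  apartCodes l = List.map (uncurry combine) (apartPairs (fst l) (snd l) l)

  apartCodes-unique : ∀ l → Unique (apartCodes l)
  apartCodes-unique l = Unique.map⁺ (uncurry-combine-injective _ _) (Unique.filter⁺ _
    (Unique.cartesianProduct⁺ (Unique.allFin⁺ _) (Unique.allFin⁺ _)))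

  -- The chosen common point lies on some line, and the traces of the two entries assigned to that
  -- line meet there.
  not-all-apart : ∀ {q} → q ∈ˡ qs → ¬ (∀ l → pairUp (tuple q) l ∈ˡ apartCodes l)
  not-all-apart {q} q∈ apart with x , x∈ , eq ← ∈-map⁻ (uncurry combine) (apart (proj₂ (point q)))
    with refl ← uncurry-combine-injective (tuple q (fst _) , tuple q (snd _)) x eq =
    apart⇒not-both (fst _) (snd _) q∈ x∈

  -- The box of all-apart tuples is disjoint from the listed ones, and by the sweep on each line it
  -- has at least `∏ rest` elements.
  intersecting-bound : AllPairs (λ p q → ¬ (∀ i → tuple p i ≡ tuple q i)) qs →
    length qs ℕ.+ ∏ rest ℕ.≤ ∏ n
  intersecting-bound qs! = begin
    length qs ℕ.+ ∏ rest
      ≡⟨ ≡.cong₂ ℕ._+_ (length-map (pairUp ∘ tuple) qs) (≡.sym (∏-halves d rest)) ⟨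
    length ps ℕ.+ ∏ (λ l → rest (fst l) ℕ.* rest (snd l))
      ≤⟨ ℕ.+-monoʳ-≤ (length ps) (∏-mono-≤ λ l → length-apartPairs (fst l) (snd l) l) ⟩
    length ps ℕ.+ ∏ (λ l → length (apartPairs (fst l) (snd l) l))
      ≤⟨ ℕ.+-monoʳ-≤ (length ps) (∏-mono-≤ λ l →
        ℕ.≤-reflexive (≡.sym (length-map (uncurry combine) (apartPairs (fst l) (snd l) l)))) ⟩
    length ps ℕ.+ ∏ (λ l → length (apartCodes l))         ≤⟨ tuples-bound apartCodes apartCodes-unique
      (AllPairs.map⁺ (AllPairs.map (λ {p} {q} p≠q eq → p≠q (pairUp-injective (tuple p) (tuple q) eq)) qs!))
      (All.map⁺ (All.tabulate not-all-apart)) ⟩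
    ∏ (λ l → n (fst l) ℕ.* n (snd l))                     ≡⟨ ∏-halves d n ⟨
    ∏ n                                                   ∎
    where
    open ℕ.≤-Reasoning
    ps = List.map (pairUp ∘ tuple) qs

  module _ where

    open CompleteOrderedField ℝ hiding (zero)
    open OrderedField ℝ
    open DecTotalOrder decTotalOrder using (_≤?_; preorder)
    open RingProperties ring using (//-rightDividesˡ)
    open PreorderReasoning preorder

    deep-family : ∀ {α β γ} → 1 ℕ.≤ d → IsRoot (2 ℕ.* d) (1# - α) γ → β ≈ 1# - γ →
      AllPairs (λ p q → ¬ (∀ i → tuple p i ≡ tuple q i)) qs →
      α * fromℕ (∏ n) ≤ fromℕ (length qs) →
      ∃ λ i → β * fromℕ (n i) ≤ fromℕ (maxDepth i)
    deep-family {α} {β} {γ} 1≤d root β≈1-γ qs! α∏n≤ =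
      -- The search runs over finitely many decidable inequalities, so it suffices to refute that
      -- all of them fail.
      decidable-stable (Fin.any? λ i → (β * fromℕ (n i)) ≤? fromℕ (maxDepth i)) λ shallow →
        ∏-strict (IsRoot.nonNeg root) (ℕ.≤-trans 1≤d (ℕ.m≤m+n d _)) n rest
          (λ i → shallow ∘ (i ,_) ∘ deep i) few-apart
      where
      -- Used contrapositively: if `maxDepth i` is below `β * fromℕ (n i)`, then `rest i` exceeds
      -- `γ * fromℕ (n i)`.
      deep : ∀ i → fromℕ (rest i) ≤ γ * fromℕ (n i) → β * fromℕ (n i) ≤ fromℕ (maxDepth i)
      deep i rest≤ = +-cancelˡ-≤ (γ * fromℕ (n i)) (begin
        γ * fromℕ (n i) + β * fromℕ (n i)     ≈⟨ partition (fromℕ (n i)) γ+β≈1 ⟩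
        fromℕ (n i)                           ≲⟨ fromℕ-mono-≤ (ℕ.≤-trans
          (ℕ.m≤n+m∸n (n i) (maxDepth i)) (ℕ.≤-reflexive (ℕ.+-comm (maxDepth i) (rest i)))) ⟩
        fromℕ (rest i ℕ.+ maxDepth i)         ≈⟨ fromℕ-+ (rest i) (maxDepth i) ⟩
        fromℕ (rest i) + fromℕ (maxDepth i)   ≲⟨ +-monoˡ-≤ (fromℕ (maxDepth i)) rest≤ ⟩
        γ * fromℕ (n i) + fromℕ (maxDepth i)  ∎)
        where
        γ+β≈1 : γ + β ≈ 1#
        γ+β≈1 = trans (+-comm γ β) (trans (+-congʳ β≈1-γ) (//-rightDividesˡ γ 1#))

      -- The listed tuples take up at least the fraction `α` of all tuples, which leaves at most
      -- `1# - α`, that is `γ ^ (2 * d)`, for `∏ rest`.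
      few-apart : fromℕ (∏ rest) ≤ γ ^ (2 ℕ.* d) * fromℕ (∏ n)
      few-apart = +-cancelˡ-≤ (α * fromℕ (∏ n)) (begin
        α * fromℕ (∏ n) + fromℕ (∏ rest)                         ≲⟨ +-monoˡ-≤ (fromℕ (∏ rest)) α∏n≤ ⟩
        fromℕ (length qs) + fromℕ (∏ rest)                       ≈⟨ fromℕ-+ (length qs) (∏ rest) ⟨
        fromℕ (length qs ℕ.+ ∏ rest)                             ≲⟨ fromℕ-mono-≤ (intersecting-bound qs!) ⟩
        fromℕ (∏ n)                                              ≈⟨ partition (fromℕ (∏ n)) α+γ^2d≈1 ⟨
        α * fromℕ (∏ n) + γ ^ (2 ℕ.* d) * fromℕ (∏ n)            ∎)
        where
        α+γ^2d≈1 : α + γ ^ (2 ℕ.* d) ≈ 1#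
        α+γ^2d≈1 = trans (+-comm α _) (trans (+-congʳ (IsRoot.power root)) (//-rightDividesˡ α 1#))

-- The colorful fractional Helly bound.

theorem6 : ∀ {ℓ} (ℝ : CompleteOrderedField ℓ) (d : ℕ) → 1 ℕ.≤ d →
    let open CompleteOrderedField ℝ
        open DIntervals ℝ d
        open FiniteSubfamily
    in
    (P : Pred Point ℓ) → P Respects _≈ₚ_ →
    (α β γ : Carrier) → 0# < α → α ≤ 1# →
    IsRoot (2 ℕ.* d) (1# - α) γ → β ≈ 1# - γ →
    (C : Fin (2 ℕ.* d) → FiniteSubfamily P) →
    (∃ λ (ts : List (ColorfulTuple C)) →
       AllDistinct C ts × All (Intersecting C) ts ×
       α * fromℕ (∏sizes C) ≤ fromℕ (length ts)) →
    ∃ λ i → ∃ λ (D : Subset (size (C i))) →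
      β * fromℕ (size (C i)) ≤ fromℕ ∣ D ∣ ×
      (∃ λ p → ∀ {a} → a ∈ D → member (C i) a p)
theorem6 ℝ d 1≤d P _ α β γ _ _ root β≈1-γ C (ts , ts! , ints , α∏≤) =
  let i , β≤             = Counting.deep-family ℝ d C qs 1≤d root β≈1-γ qs! α∏≤′
      -- `1 ≤ d` provides a line and hence a default point, in case the subfamily is empty.
      D , ∣D∣≡ , stabbed = Incidences.maxDepth-attained ℝ d C qs (0# , fromℕ< 1≤d) i
  in i , D , ≡.subst (λ k → β * fromℕ (size (C i)) ≤ fromℕ k) (≡.sym ∣D∣≡) β≤ , stabbed
  where
  open CompleteOrderedField ℝ using (_≤_; fromℕ; 0#; _*_)
  open DIntervals ℝ d
  open FiniteSubfamily
  -- Each listed tuple is bundled with its chosen common point.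
  qs  = All.toList ints
  ts≡ = ≡.sym (map-proj₁-toList ints)
  qs! : AllPairs (λ p q → ¬ (∀ i → proj₁ p i ≡ proj₁ q i)) qs
  qs! = AllPairs.map⁻ (≡.subst (AllDistinct C) ts≡ ts!)
  α∏≤′ : α * fromℕ (∏sizes C) ≤ fromℕ (length qs)
  α∏≤′ = ≡.subst (λ k → α * fromℕ (∏sizes C) ≤ fromℕ k)
    (≡.trans (≡.cong length ts≡) (length-map proj₁ qs)) α∏≤
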